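{- Suppose $G$ is a graph of order $p$ and size $q$ with exactly one vertex of maximum degree $\Delta\ge 3$, that this vertex is not adjacent to any pendant vertex, and that all other vertices of $G$ have degree at most $m<\Delta$. Moreover, suppose $G$ has $k\ge\Delta\ge 2$ pendant edges and that $$\Delta(\Delta+1)>\max\{\,m[2(p+q)-m+1],\ 4(p+q)-2\,\}.$$ If $G$ admits a local total antimagic labeling, then $\chi_{lt}(G)\ge k+2$.
   Context: All graphs are finite, simple and loopless, of order $p=|V|\ge 3$ and size $q=|E|\ge 2$, with no isolated vertex and no $K_2$ component (graphs may be disconnected). A pendant vertex is a vertex of degree 1; a pendant edge is an edge incident to a pendant vertex. A local total antimagic labeling of $G=(V,E)$ is a bijection $f:V\cup E\to\{1,\dots,p+q\}$ such that, with weights $w_f(u)=\sum f(e)$ over all edges $e$ incident to $u$ for $u\in V$ (the label of $u$ itself is not included) and $w_f(uv)=f(u)+f(v)$ for $uv\in E$, one has: adjacent vertices have distinct weights, adjacent edges have distinct weights, and every vertex has a weight distinct from that of each of its incident edges. $\chi_{lt}(G)$ is the minimum, over all local total antimagic labelings $f$ of $G$, of the number of distinct values among all the vertex and edge weights. -}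

module Defs where

open import Data.Fin using (Fin; toℕ; _<_)
open import Data.Fin.Properties using (any?) renaming (_≟_ to _≟ᶠ_)
open import Data.List using (List; _++_; allFin; deduplicate; filter; length; map; sum)
open import Data.List.Extrema.Nat using (max)
open import Data.Nat using (ℕ; suc; _+_; _≤_; _≟_)
open import Data.Product using (Σ; ∃; _×_; _,_)
open import Data.Sum using (_⊎_; inj₁; inj₂)
open import Function using (_⤖_; Bijection)
open import Relation.Binary.Construct.Closure.ReflexiveTransitive using (Star)
open import Relation.Binary.PropositionalEquality using (_≡_; _≢_)
open import Relation.Nullary using (Dec)
open import Relation.Nullary.Decidable using (_×-dec_; _⊎-dec_)

-- A finite simple graph with vertex set Fin p and edge set Fin q.  The
-- two-element set of endpoints of e is stored as the increasing pair
-- lo e < hi e (so there are no loops), and an edge is determined by its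
-- endpoints (so there are no parallel edges).
record Graph (p q : ℕ) : Set where
  field
    lo hi     : Fin q → Fin p
    lo<hi     : ∀ e → lo e < hi e
    ends-inj  : ∀ {e e′} → lo e ≡ lo e′ → hi e ≡ hi e′ → e ≡ e′

module _ {p q : ℕ} (G : Graph p q) where
  open Graph G

  Incident : Fin p → Fin q → Set
  Incident u e = u ≡ lo e ⊎ u ≡ hi e

  incident? : ∀ u e → Dec (Incident u e)
  incident? u e = (u ≟ᶠ lo e) ⊎-dec (u ≟ᶠ hi e)

  Adjacent : Fin p → Fin p → Set
  Adjacent u v = u ≢ v × ∃ λ e → Incident u e × Incident v e

  AdjacentEdges : Fin q → Fin q → Set
  AdjacentEdges e e′ = e ≢ e′ × ∃ λ u → Incident u e × Incident u e′

  incidentEdges : Fin p → List (Fin q)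
  incidentEdges u = filter (incident? u) (allFin q)

  degree : Fin p → ℕ
  degree u = length (incidentEdges u)

  maxDegree : ℕ
  maxDegree = max 0 (map degree (allFin p))

  Isolated : Fin p → Set
  Isolated u = degree u ≡ 0

  -- The connected component of u has vertex set {u , v} and is a K₂.
  K₂Component : Fin p → Fin p → Set
  K₂Component u v = Adjacent u v × (∀ w → Star Adjacent u w → w ≡ u ⊎ w ≡ v)

  Pendant : Fin p → Set
  Pendant u = degree u ≡ 1

  PendantEdge : Fin q → Set
  PendantEdge e = ∃ λ u → Incident u e × Pendant u

  pendantEdge? : ∀ e → Dec (PendantEdge e)
  pendantEdge? e = any? λ u → incident? u e ×-dec (degree u ≟ 1)

  pendantEdgeCount : ℕ
  pendantEdgeCount = length (filter pendantEdge? (allFin q))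

-- V ∪ E is Fin p ⊎ Fin q; the label set {1 , … , p + q} is Fin (p + q)
-- shifted by one, see label.
TotalLabeling : ℕ → ℕ → Set
TotalLabeling p q = (Fin p ⊎ Fin q) ⤖ Fin (p + q)

label : ∀ {p q} → TotalLabeling p q → Fin p ⊎ Fin q → ℕ
label f x = suc (toℕ (Bijection.to f x))

module _ {p q : ℕ} (G : Graph p q) where
  open Graph G

  weight : TotalLabeling p q → Fin p ⊎ Fin q → ℕ
  weight f (inj₁ u) = sum (map (λ e → label f (inj₂ e)) (incidentEdges G u))
  weight f (inj₂ e) = label f (inj₁ (lo e)) + label f (inj₁ (hi e))

  record IsLocalTotalAntimagic (f : TotalLabeling p q) : Set where
    field
      vertex-vertex : ∀ {u v} → Adjacent G u v →
                      weight f (inj₁ u) ≢ weight f (inj₁ v)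
      edge-edge     : ∀ {e e′} → AdjacentEdges G e e′ →
                      weight f (inj₂ e) ≢ weight f (inj₂ e′)
      vertex-edge   : ∀ {u e} → Incident G u e →
                      weight f (inj₁ u) ≢ weight f (inj₂ e)

  LocalTotalAntimagicLabeling : Set
  LocalTotalAntimagicLabeling = Σ (TotalLabeling p q) IsLocalTotalAntimagic

  weights : TotalLabeling p q → List ℕ
  weights f = map (weight f) (map inj₁ (allFin p) ++ map inj₂ (allFin q))

  weightCount : LocalTotalAntimagicLabeling → ℕ
  weightCount (f , _) = length (deduplicate _≟_ (weights f))

  -- Is-χₗₜ c says that χₗₜ(G) = c, i.e. that c is the minimum of weightCount.
  -- It is a relation because χₗₜ is undefined for graphs without a labeling.
  Is-χₗₜ : ℕ → Set
  Is-χₗₜ c = (∃ λ F → weightCount F ≡ c) × (∀ F → c ≤ weightCount F)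

-- Every pendant edge label is the weight of a pendant
-- vertex, giving k distinct weights at most p + q. The vertex x of maximum
-- degree has weight at least Δ(Δ+1)/2, which exceeds every edge weight and the
-- weight of every other vertex. Finally the label p + q forces one more weight
-- above p + q: if it sits on a vertex, on any incident edge; if it sits on an
-- edge, on an endpoint of that edge other than x and of degree at least 2,
-- which exists because x has no pendant neighbour and G has no K₂ component.
module Submission where

open import Defs
open import Data.Fin using (Fin; toℕ; fromℕ<) renaming (zero to fzero; suc to fsuc)
open import Data.Fin.Properties
  using (toℕ<n; toℕ-injective; toℕ-fromℕ<; injective⇒≤)
  renaming (_≟_ to _≟ᶠ_; <⇒≢ to <ᶠ⇒≢)
open import Data.List using (List; []; _∷_; allFin; deduplicate; filter; length; lookup; map)
open import Data.List.Properties using (length-map; length-filter; length-tabulate)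
open import Data.List.Membership.Propositional using (_∈_)
open import Data.List.Membership.Propositional.Properties
  using (∈-map⁺; ∈-map⁻; ∈-filter⁺; ∈-filter⁻; ∈-allFin; ∈-++⁺ˡ; ∈-++⁺ʳ; ∈-lookup; ∈-deduplicate⁺)
open import Data.List.Membership.Setoid.Properties using (index-injective)
open import Data.List.Relation.Binary.Permutation.Propositional using (↭-sym; ↭⇒↭ₛ)
open import Data.List.Relation.Binary.Permutation.Propositional.Properties
  using (All-resp-↭; ↭-length)
open import Data.List.Relation.Binary.Permutation.Setoid.Properties using (Unique-resp-↭)
open import Data.List.Relation.Binary.Subset.Propositional using (_⊆_)
open import Data.List.Relation.Unary.All as All using (All; []; _∷_)
open import Data.List.Relation.Unary.All.Properties using () renaming (map⁺ to All-map⁺)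
open import Data.List.Relation.Unary.AllPairs as AllPairs using (AllPairs; []; _∷_)
open import Data.List.Relation.Unary.Any using (here; there; index)
open import Data.List.Relation.Unary.Sorted.TotalOrder.Properties using (Sorted⇒AllPairs)
open import Data.List.Relation.Unary.Unique.Propositional using (Unique)
open import Data.List.Relation.Unary.Unique.Propositional.Properties
  using (map⁺; filter⁺; allFin⁺)
open import Data.Nat
  using (ℕ; suc; _+_; _*_; _∸_; _⊔_; _≤_; _<_; _≥_; _>_; _≟_; z≤n; s≤s; z<s)
open import Data.Nat.ListAction using (sum)
open import Data.Nat.ListAction.Properties using (sum-↭)
open import Data.Nat.Properties hiding (_≟_)
open import Data.Nat.Tactic.RingSolver using (solve-∀)
open import Data.Product using (∃; _×_; _,_; proj₂)
open import Data.Sum using (inj₁; inj₂)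
open import Data.Sum.Properties using (inj₁-injective; inj₂-injective)
open import Function using (_∘_; Bijection)
open import Relation.Binary.Construct.Closure.ReflexiveTransitive using (Star; ε; _◅_)
open import Relation.Binary.PropositionalEquality
  using (_≡_; _≢_; refl; sym; trans; cong; cong₂; subst; subst₂; setoid; ≢-sym; module ≡-Reasoning)
open import Relation.Nullary using (¬_; yes; no; contradiction)
open import Data.List.Sort ≤-decTotalOrder using (sort; sort-↭; sort-↗)

-- Counting and sums for lists without repetition

lookup-injective : ∀ {A : Set} {xs : List A} → Unique xs →
                   ∀ {i j} → lookup xs i ≡ lookup xs j → i ≡ j
lookup-injective (_ ∷ _) {fzero}  {fzero}  _  = refl
lookup-injective (p ∷ _) {fzero}  {fsuc j} eq = contradiction eq (All.lookup p (∈-lookup j))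
lookup-injective (p ∷ _) {fsuc i} {fzero}  eq = contradiction (sym eq) (All.lookup p (∈-lookup i))
lookup-injective (_ ∷ u) {fsuc i} {fsuc j} eq = cong fsuc (lookup-injective u eq)

-- Sending each position in `xs` to a position of the same entry in `ys` is injective, since equal
-- targets carry equal entries and `xs` repeats none.
Unique-⊆⇒length≤ : ∀ {A : Set} {xs ys : List A} → Unique xs → xs ⊆ ys → length xs ≤ length ys
Unique-⊆⇒length≤ {A} {xs} u xs⊆ys = injective⇒≤ {f = λ i → index (xs⊆ys (∈-lookup {xs = xs} i))}
  (λ eq → lookup-injective u (index-injective (setoid A) (xs⊆ys (∈-lookup _)) (xs⊆ys (∈-lookup _)) eq))

-- The entries dominate `a + 1`, `a + 2`, and so on, one by one. The threshold `a` is kept general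
-- because the tail lies above `suc a`.
strictlyAscending-sum-bound : ∀ a xs → AllPairs _<_ xs → All (a <_) xs →
  length xs * (2 * a + length xs + 1) ≤ 2 * sum xs
strictlyAscending-sum-bound a []       _          _           = z≤n
strictlyAscending-sum-bound a (x ∷ xs) (x<xs ∷ s) (a<x ∷ _) = begin
  suc n * (2 * a + suc n + 1)               ≡⟨ split a n ⟩
  2 * suc a + n * (2 * suc a + n + 1)       ≤⟨ +-mono-≤ (*-monoʳ-≤ 2 a<x)
                                                 (strictlyAscending-sum-bound (suc a) xs s
                                                   (All.map (≤-<-trans a<x) x<xs)) ⟩
  2 * x + 2 * sum xs                        ≡⟨ *-distribˡ-+ 2 x (sum xs) ⟨
  2 * (x + sum xs)                          ∎
  where
  open ≤-Reasoning
  n = length xs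
  split : ∀ a n → suc n * (2 * a + suc n + 1) ≡ 2 * suc a + n * (2 * suc a + n + 1)
  split = solve-∀

-- Sorting preserves length and sum, and distinctness makes the sorted list strictly ascending.
Unique-sum-lower : ∀ xs → Unique xs → All (0 <_) xs → length xs * (length xs + 1) ≤ 2 * sum xs
Unique-sum-lower xs u pos = subst₂ (λ n s → n * (n + 1) ≤ 2 * s)
  (↭-length (sort-↭ xs)) (sum-↭ (sort-↭ xs))
  (strictlyAscending-sum-bound 0 (sort xs)
    (AllPairs.zipWith (λ (x≤y , x≢y) → ≤∧≢⇒< x≤y x≢y)
      ( Sorted⇒AllPairs ≤-totalOrder (sort-↗ xs)
      , Unique-resp-↭ (setoid ℕ) (↭⇒↭ₛ xs↭) u))
    (All-resp-↭ xs↭ pos))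
  where xs↭ = ↭-sym (sort-↭ xs)

-- Truncated subtraction from `N` is injective on arguments up to `N`, hence the bound on the
-- entries.
Unique-map-∸ : ∀ N {xs} → Unique xs → All (_≤ N) xs → Unique (map (N ∸_) xs)
Unique-map-∸ N []      []       = []
Unique-map-∸ N (p ∷ u) (q ∷ qs) =
  All-map⁺ (All.zipWith (λ (x≢y , y≤N) → x≢y ∘ ∸-cancelˡ-≡ q y≤N) (p , qs))
  ∷ Unique-map-∸ N u qs

sum-map-∸ : ∀ N {xs} → All (_≤ N) xs → sum xs + sum (map (N ∸_) xs) ≡ length xs * N
sum-map-∸ N []                  = refl
sum-map-∸ N (_∷_ {x} {xs} q qs) = begin
  (x + sum xs) + ((N ∸ x) + sum (map (N ∸_) xs))  ≡⟨ interchange x _ _ _ ⟩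
  (x + (N ∸ x)) + (sum xs + sum (map (N ∸_) xs))  ≡⟨ cong₂ _+_ (m+[n∸m]≡n q) (sum-map-∸ N qs) ⟩
  N + length xs * N                               ∎
  where
  open ≡-Reasoning
  interchange : ∀ a b c d → (a + b) + (c + d) ≡ (a + c) + (b + d)
  interchange = solve-∀

-- The lower bound applied to the reflected list of all N + 1 - x.
Unique-sum-upper : ∀ N xs → Unique xs → All (_≤ N) xs →
  2 * sum xs + length xs * (length xs + 1) ≤ 2 * (length xs * suc N)
Unique-sum-upper N xs u bound = begin
  2 * sum xs + n * (n + 1)    ≤⟨ +-monoʳ-≤ (2 * sum xs) lower ⟩
  2 * sum xs + 2 * sum ys     ≡⟨ *-distribˡ-+ 2 (sum xs) (sum ys) ⟨
  2 * (sum xs + sum ys)       ≡⟨ cong (2 *_) (sum-map-∸ (suc N) bound′) ⟩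
  2 * (n * suc N)             ∎
  where
  open ≤-Reasoning
  n = length xs
  ys = map (suc N ∸_) xs
  bound′ = All.map m≤n⇒m≤1+n bound
  -- Reflecting with `suc N` rather than `N` keeps the image of the entry `N` positive.
  positive : All (0 <_) ys
  positive = All.tabulate λ y∈ → let x , x∈ , eq = ∈-map⁻ (suc N ∸_) y∈ in
    subst (0 <_) (sym eq) (m<n⇒0<n∸m (s≤s (All.lookup bound x∈)))
  lower : n * (n + 1) ≤ 2 * sum ys
  lower = subst (λ l → l * (l + 1) ≤ 2 * sum ys) (length-map (suc N ∸_) xs)
    (Unique-sum-lower ys (Unique-map-∸ (suc N) u bound′) positive)

-- The bound `n * (2 * N ∸ n + 1)` for exactly `n` entries increases with `n` up to `N`, so `n` may
-- be replaced by the larger `m`.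
short-Unique-sum-upper : ∀ {N m} xs → Unique xs → All (_≤ N) xs → length xs ≤ m → m ≤ N →
  2 * sum xs ≤ m * (2 * N ∸ m + 1)
short-Unique-sum-upper {N} xs u bound n≤m m≤N
  -- The gaps `j` from `n` to `m` and `r` from `m` to `N` turn truncated subtraction into polynomial
  -- arithmetic.
  with m≤n⇒∃[o]m+o≡n n≤m | m≤n⇒∃[o]m+o≡n m≤N
... | j , refl | r , refl = +-cancelʳ-≤ (n * (n + 1)) _ _ (begin
  2 * sum xs + n * (n + 1)                                ≤⟨ Unique-sum-upper N xs u bound ⟩
  -- The added term is exactly the difference between the bounds for `m` and for `n` entries.
  2 * (n * suc (m + r))                                   ≤⟨ m≤m+n _ (j * j + 2 * j * r + j) ⟩
  2 * (n * suc (m + r)) + (j * j + 2 * j * r + j)         ≡⟨ expand n j r ⟩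
  m * (m + 2 * r + 1) + n * (n + 1)                       ≡⟨ cong (λ t → m * (t + 1) + n * (n + 1)) twice ⟨
  m * (2 * N ∸ m + 1) + n * (n + 1)                       ∎)
  where
  open ≤-Reasoning
  n = length xs
  m = n + j
  expand : ∀ n j r → 2 * (n * suc (n + j + r)) + (j * j + 2 * j * r + j)
                   ≡ (n + j) * (n + j + 2 * r + 1) + n * (n + 1)
  expand = solve-∀
  double : ∀ m r → 2 * (m + r) ≡ m + (m + 2 * r)
  double = solve-∀
  twice : 2 * (m + r) ∸ m ≡ m + 2 * r
  twice = trans (cong (_∸ m) (double m r)) (m+n∸m≡n m (m + 2 * r))

∈⇒≤sum : ∀ {x xs} → x ∈ xs → x ≤ sum xs
∈⇒≤sum {xs = y ∷ ys} (here refl) = m≤m+n y (sum ys)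
∈⇒≤sum {xs = y ∷ ys} (there x∈)  = m≤n⇒m≤o+n y (∈⇒≤sum x∈)

∈⇒<sum : ∀ {x xs} → x ∈ xs → 2 ≤ length xs → All (0 <_) xs → x < sum xs
∈⇒<sum {xs = x ∷ y ∷ ys} (here refl) _ (_ ∷ 0<y ∷ _) = m<m+n x (≤-trans 0<y (m≤m+n y (sum ys)))
∈⇒<sum {xs = x ∷ y ∷ ys} (there z∈)  _ (0<x ∷ _)     = +-mono-≤ 0<x (∈⇒≤sum z∈)
∈⇒<sum {xs = _ ∷ []}     _ (s≤s ()) _

singleton-∈ : ∀ {A : Set} {x : A} {xs} → x ∈ xs → length xs ≡ 1 → xs ≡ x ∷ []
singleton-∈ {xs = _ ∷ []} (here refl) _ = refl

0<length⇒∈ : ∀ {A : Set} (xs : List A) → length xs ≢ 0 → ∃ (_∈ xs)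
0<length⇒∈ []      n≢0 = contradiction refl n≢0
0<length⇒∈ (x ∷ _) _   = x , here refl

≢0∧≢1⇒≥2 : ∀ {n} → n ≢ 0 → n ≢ 1 → 2 ≤ n
≢0∧≢1⇒≥2 n≢0 n≢1 = ≤∧≢⇒< (n≢0⇒n>0 n≢0) (≢-sym n≢1)

-- Pendant vertices and edge endpoints

module _ {p q : ℕ} (G : Graph p q) where
  open Graph G

  incident⇒∈ : ∀ {u e} → Incident G u e → e ∈ incidentEdges G u
  incident⇒∈ {u} {e} = ∈-filter⁺ (incident? G u) (∈-allFin e)

  degree≤size : ∀ u → degree G u ≤ q
  degree≤size u = ≤-trans (length-filter (incident? G u) (allFin q))
                          (≤-reflexive (length-tabulate {n = q} (λ e → e)))

  lo≢hi : ∀ e → lo e ≢ hi e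
  lo≢hi e = <ᶠ⇒≢ (lo<hi e)

  pendant-unique : ∀ {u e e′} → Pendant G u → Incident G u e → Incident G u e′ → e′ ≡ e
  pendant-unique {e′ = e′} pu ue ue′
    with here eq ← subst (e′ ∈_) (singleton-∈ (incident⇒∈ ue) pu) (incident⇒∈ ue′) = eq

  -- Neither end lies on an edge other than `e`, so a walk from one of them can only go back and
  -- forth along `e`.
  pendant-ends⇒K₂ : ∀ e → Pendant G (lo e) → Pendant G (hi e) → K₂Component G (lo e) (hi e)
  pendant-ends⇒K₂ e plo phi = (lo≢hi e , e , inj₁ refl , inj₂ refl) , λ _ → confined (inj₁ refl)
    where
    only-e : ∀ {u e′} → Incident G u e → Incident G u e′ → e′ ≡ e
    only-e (inj₁ refl) = pendant-unique plo (inj₁ refl)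
    only-e (inj₂ refl) = pendant-unique phi (inj₂ refl)
    confined : ∀ {u w} → Incident G u e → Star (Adjacent G) u w → Incident G w e
    confined ue ε = ue
    confined ue ((_ , e′ , ue′ , ve′) ◅ path) =
      confined (subst (Incident G _) (only-e ue ue′) ve′) path

  -- If one end is `x`, the other is a neighbour of `x` and so not pendant. If neither is, two
  -- pendant ends would form a K₂ component.
  nonpendant-endpoint :
    (∀ u → ¬ Isolated G u) → (∀ u v → ¬ K₂Component G u v) →
    ∀ {x} → (∀ v → Pendant G v → ¬ Adjacent G x v) →
    ∀ e → ∃ λ u → Incident G u e × u ≢ x × 2 ≤ degree G u
  nonpendant-endpoint noIso noK₂ {x} noPendantNbr e with lo e ≟ᶠ x | hi e ≟ᶠ x
  ... | yes lo≡x | _ = hi e , inj₂ refl , (λ hi≡x → lo≢hi e (trans lo≡x (sym hi≡x)))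
        , ≢0∧≢1⇒≥2 (noIso _) λ phi → noPendantNbr (hi e) phi
            (subst (λ y → Adjacent G y (hi e)) lo≡x (lo≢hi e , e , inj₁ refl , inj₂ refl))
  ... | no lo≢x | yes hi≡x = lo e , inj₁ refl , lo≢x
        , ≢0∧≢1⇒≥2 (noIso _) λ plo → noPendantNbr (lo e) plo
            (subst (λ y → Adjacent G y (lo e)) hi≡x (≢-sym (lo≢hi e) , e , inj₂ refl , inj₁ refl))
  ... | no lo≢x | no hi≢x with degree G (lo e) ≟ 1
  ...   | no ¬plo = lo e , inj₁ refl , lo≢x , ≢0∧≢1⇒≥2 (noIso _) ¬plo
  ...   | yes plo = hi e , inj₂ refl , hi≢x
          , ≢0∧≢1⇒≥2 (noIso _) λ phi → noK₂ _ _ (pendant-ends⇒K₂ e plo phi)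

  -- Bounds on weights under a total labeling

  module _ (f : TotalLabeling p q) where

    label≤ : ∀ z → label f z ≤ p + q
    label≤ z = toℕ<n (Bijection.to f z)

    label-injective : ∀ {z z′} → label f z ≡ label f z′ → z ≡ z′
    label-injective eq = Bijection.injective f (toℕ-injective (suc-injective eq))

    label-surjective : ∀ {n} → n < p + q → ∃ λ z → label f z ≡ suc n
    label-surjective n<N = let z , eq = Bijection.strictlySurjective f (fromℕ< n<N) in
      z , cong suc (trans (cong toℕ eq) (toℕ-fromℕ< n<N))

    edgeLabel-injective : ∀ {e e′} → label f (inj₂ e) ≡ label f (inj₂ e′) → e ≡ e′
    edgeLabel-injective = inj₂-injective ∘ label-injective

    incidentLabels : Fin p → List ℕ
    incidentLabels u = map (λ e → label f (inj₂ e)) (incidentEdges G u)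

    incidentLabels-length : ∀ u → length (incidentLabels u) ≡ degree G u
    incidentLabels-length u = length-map (λ e → label f (inj₂ e)) (incidentEdges G u)

    incidentLabels-unique : ∀ u → Unique (incidentLabels u)
    incidentLabels-unique u = map⁺ edgeLabel-injective (filter⁺ (incident? G u) (allFin⁺ q))

    incidentLabels-positive : ∀ u → All (0 <_) (incidentLabels u)
    incidentLabels-positive u = All.tabulate λ l∈ →
      let _ , _ , eq = ∈-map⁻ (λ e → label f (inj₂ e)) l∈ in subst (0 <_) (sym eq) z<s

    incidentLabels-bounded : ∀ u → All (_≤ p + q) (incidentLabels u)
    incidentLabels-bounded u = All.tabulate λ l∈ →
      let e , _ , eq = ∈-map⁻ (λ e → label f (inj₂ e)) l∈ in
      subst (_≤ p + q) (sym eq) (label≤ (inj₂ e))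

    weight∈weights : ∀ z → weight G f z ∈ weights G f
    weight∈weights (inj₁ u) = ∈-map⁺ (weight G f) (∈-++⁺ˡ (∈-map⁺ inj₁ (∈-allFin u)))
    weight∈weights (inj₂ e) =
      ∈-map⁺ (weight G f) (∈-++⁺ʳ (map inj₁ (allFin p)) (∈-map⁺ inj₂ (∈-allFin e)))

    vertexWeight-lower : ∀ u → degree G u * (degree G u + 1) ≤ 2 * weight G f (inj₁ u)
    vertexWeight-lower u = subst (λ d → d * (d + 1) ≤ 2 * weight G f (inj₁ u))
      (incidentLabels-length u)
      (Unique-sum-lower (incidentLabels u) (incidentLabels-unique u) (incidentLabels-positive u))

    vertexWeight-upper : ∀ {m} u → degree G u ≤ m → m ≤ p + q →
                         2 * weight G f (inj₁ u) ≤ m * (2 * (p + q) ∸ m + 1)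
    vertexWeight-upper u d≤m = short-Unique-sum-upper
      (incidentLabels u) (incidentLabels-unique u) (incidentLabels-bounded u)
      (≤-trans (≤-reflexive (incidentLabels-length u)) d≤m)

    -- The two ends carry distinct labels up to `p + q`, so their sum is at most `2 * (p + q) - 1`.
    -- All weight bounds are stated doubled to avoid halving `Δ * (Δ + 1)`.
    edgeWeight-upper : ∀ e → 2 * weight G f (inj₂ e) ≤ 4 * (p + q) ∸ 2
    edgeWeight-upper e = begin
      2 * (a + b)                       ≡⟨ m+n∸n≡m (2 * (a + b)) 2 ⟨
      2 * (a + b) + 2 ∸ 2               ≡⟨ cong (_∸ 2) (regroup a b) ⟩
      2 * suc (a + b) ∸ 2               ≤⟨ ∸-monoˡ-≤ 2 (*-monoʳ-≤ 2 a+b<2N) ⟩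
      2 * (p + q + (p + q)) ∸ 2         ≡⟨ cong (_∸ 2) (quadruple (p + q)) ⟩
      4 * (p + q) ∸ 2                   ∎
      where
      open ≤-Reasoning
      a = label f (inj₁ (lo e))
      b = label f (inj₁ (hi e))
      a≢b : a ≢ b
      a≢b = lo≢hi e ∘ inj₁-injective ∘ label-injective
      a+b<2N : a + b < p + q + (p + q)
      a+b<2N with a ≟ p + q
      -- At most one of the two labels equals `p + q`; the other supplies the strict inequality.
      ... | yes a≡N = +-mono-≤-< (label≤ _) (≤∧≢⇒< (label≤ _) (a≢b ∘ trans a≡N ∘ sym))
      ... | no a≢N  = +-mono-<-≤ (≤∧≢⇒< (label≤ _) a≢N) (label≤ _)
      regroup : ∀ a b → 2 * (a + b) + 2 ≡ 2 * suc (a + b)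
      regroup = solve-∀
      quadruple : ∀ N → 2 * (N + N) ≡ 4 * N
      quadruple = solve-∀

    endLabel<edgeWeight : ∀ {u e} → Incident G u e → label f (inj₁ u) < weight G f (inj₂ e)
    endLabel<edgeWeight (inj₁ refl) = m<m+n _ z<s
    endLabel<edgeWeight (inj₂ refl) = m<n+m _ z<s

    -- A second edge at `u` contributes a further positive label.
    edgeLabel<vertexWeight : ∀ {u e} → Incident G u e → 2 ≤ degree G u →
                             label f (inj₂ e) < weight G f (inj₁ u)
    edgeLabel<vertexWeight {u} ue 2≤d = ∈⇒<sum (∈-map⁺ (λ e → label f (inj₂ e)) (incident⇒∈ ue))
      (≤-trans 2≤d (≤-reflexive (sym (incidentLabels-length u)))) (incidentLabels-positive u)

    pendantLabels : List ℕ
    pendantLabels = map (λ e → label f (inj₂ e)) (filter (pendantEdge? G) (allFin q))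

    -- The sum defining the weight of a pendant vertex has the label of its only edge as single
    -- term.
    pendantLabels⊆weights : pendantLabels ⊆ weights G f
    pendantLabels⊆weights l∈
      with e , e∈ , refl ← ∈-map⁻ (λ e → label f (inj₂ e)) l∈
      with u , ue , pu ← proj₂ (∈-filter⁻ (pendantEdge? G) {xs = allFin q} e∈)
      = subst (_∈ weights G f) pendantWeight (weight∈weights (inj₁ u))
      where
      pendantWeight : weight G f (inj₁ u) ≡ label f (inj₂ e)
      pendantWeight = trans (cong (λ es → sum (map (λ e → label f (inj₂ e)) es))
                                  (singleton-∈ (incident⇒∈ ue) pu))
                            (+-identityʳ _)

    pendantLabels-bounded : All (_≤ p + q) pendantLabels
    pendantLabels-bounded = All.tabulate λ l∈ →
      let e , _ , eq = ∈-map⁻ (λ e → label f (inj₂ e)) l∈ in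
      subst (_≤ p + q) (sym eq) (label≤ (inj₂ e))

    -- Pendant labels are pairwise distinct and at most `p + q`, so two different weights above
    -- `p + q` extend them to a list without repetition.
    pendantCount+2≤ : ∀ {y z} → p + q < weight G f y → weight G f y < weight G f z →
                      pendantEdgeCount G + 2 ≤ length (deduplicate _≟_ (weights G f))
    pendantCount+2≤ {y} {z} N<wy wy<wz = begin
      pendantEdgeCount G + 2             ≡⟨ +-comm _ 2 ⟩
      2 + pendantEdgeCount G             ≡⟨ cong (2 +_) (length-map _ (filter (pendantEdge? G) (allFin q))) ⟨
      length (weight G f z ∷ weight G f y ∷ pendantLabels)
                                         ≤⟨ Unique-⊆⇒length≤ unique (∈-deduplicate⁺ _≟_ ∘ occurs) ⟩
      length (deduplicate _≟_ (weights G f)) ∎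
      where
      open ≤-Reasoning
      above : ∀ {n} → p + q < n → All (n ≢_) pendantLabels
      above N<n = All.map (λ l≤N → >⇒≢ (≤-<-trans l≤N N<n)) pendantLabels-bounded
      unique : Unique (weight G f z ∷ weight G f y ∷ pendantLabels)
      unique = (>⇒≢ wy<wz ∷ above (<-trans N<wy wy<wz)) ∷ above N<wy
             ∷ map⁺ edgeLabel-injective (filter⁺ (pendantEdge? G) (allFin⁺ q))
      occurs : (weight G f z ∷ weight G f y ∷ pendantLabels) ⊆ weights G f
      occurs (here refl)         = weight∈weights z
      occurs (there (here refl)) = weight∈weights y
      occurs (there (there l∈))  = pendantLabels⊆weights l∈

-- The lower bound for the local total antimagic chromatic number

theorem2p6 : ∀ (p q : ℕ) (G : Graph p q) →
    p ≥ 3 → q ≥ 2 →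
    (∀ u → ¬ Isolated G u) →
    (∀ u v → ¬ K₂Component G u v) →
    ∀ (Δ m k : ℕ) (x : Fin p) →
    Δ ≡ maxDegree G → Δ ≥ 3 →
    degree G x ≡ Δ →
    (∀ u → degree G u ≡ Δ → u ≡ x) →
    (∀ v → Pendant G v → ¬ Adjacent G x v) →
    (∀ u → u ≢ x → degree G u ≤ m) → m < Δ →
    k ≡ pendantEdgeCount G → k ≥ Δ → Δ ≥ 2 →
    Δ * (Δ + 1) > (m * (2 * (p + q) ∸ m + 1)) ⊔ (4 * (p + q) ∸ 2) →
    LocalTotalAntimagicLabeling G →
    ∀ c → Is-χₗₜ G c → c ≥ k + 2
-- Matching `p` as a successor exposes the predecessor of `p + q`, so `≤-refl` lets
-- `label-surjective` locate the largest label. The labeling `f` is one attaining the minimum `c`.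
theorem2p6 p@(suc _) q G _ _ noIso noK₂ Δ m k x _ _ refl _ noPendantNbr deg≤m m<Δ refl _ _ big _
           c (((f , lta) , refl) , _) = bound (label-surjective G f ≤-refl)
  where
  wx = weight G f (inj₁ x)

  -- This places `m` in the range where the bound on vertex weights is monotone: `m < Δ ≤ q`.
  m≤N : m ≤ p + q
  m≤N = ≤-trans (<⇒≤ m<Δ) (≤-trans (degree≤size G x) (m≤n+m q p))

  -- The distinct labels around `x` give `Δ * (Δ + 1) ≤ 2 * wx`, so either side of the maximum in
  -- `big` can serve as `b`.
  below-wx : ∀ {w b} → 2 * w ≤ b → b < Δ * (Δ + 1) → w < wx
  below-wx 2w≤b b< = *-cancelˡ-< 2 _ _ (≤-<-trans 2w≤b (<-≤-trans b< (vertexWeight-lower G f x)))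

  bound : (∃ λ z → label f z ≡ p + q) → pendantEdgeCount G + 2 ≤ weightCount G (f , lta)
  bound (inj₁ v , lab≡N) =
    let e , e∈ = 0<length⇒∈ (incidentEdges G v) (noIso v)
        ve = proj₂ (∈-filter⁻ (incident? G v) {xs = allFin q} e∈)
    in pendantCount+2≤ G f {inj₂ e} {inj₁ x}
         (subst (_< weight G f (inj₂ e)) lab≡N (endLabel<edgeWeight G f ve))
         (below-wx (edgeWeight-upper G f e) (m⊔n<o⇒n<o _ _ big))
  bound (inj₂ e , lab≡N) =
    let u , ue , u≢x , 2≤d = nonpendant-endpoint G noIso noK₂ noPendantNbr e
    in pendantCount+2≤ G f {inj₁ u} {inj₁ x}
         (subst (_< weight G f (inj₁ u)) lab≡N (edgeLabel<vertexWeight G f ue 2≤d))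
         (below-wx (vertexWeight-upper G f u (deg≤m u u≢x) m≤N) (m⊔n<o⇒m<o _ _ big))
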